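{- Let $\mathscr{H}$ be the class of all (finite, simple) graphs $G$ on at least twelve vertices with $\gamma(G)=2$. Then $\mathscr{H}$ is recognizable: if $G\in\mathscr{H}$ and $H$ is any graph with $\mathscr{D}(H)=\mathscr{D}(G)$, then $H\in\mathscr{H}$.
   Context: All graphs are finite, simple and undirected. $\gamma(G)$ is the domination number of $G$ (the minimum size of a set $S\subseteq V(G)$ such that every vertex outside $S$ has a neighbour in $S$). For a vertex $v$, the card $G-v$ is the unlabeled graph obtained by deleting $v$ and its incident edges; the deck $\mathscr{D}(G)$ is the multiset of all cards of $G$ (up to isomorphism). A graph $H$ with $\mathscr{D}(H)=\mathscr{D}(G)$ is a reconstruction of $G$. A class $\mathcal{F}$ of graphs is recognizable if every reconstruction of every graph in $\mathcal{F}$ also lies in $\mathcal{F}$. -}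

module Defs where

open import Data.Bool.Base using (Bool; false; T)
open import Data.Fin.Base using (Fin; punchIn)
open import Data.Fin.Permutation using (Permutation; id; flip; _∘ₚ_; _⟨$⟩ʳ_; _⟨$⟩ˡ_; inverseʳ)
open import Data.Fin.Subset using (Subset; ∣_∣; _∈_; _∉_)
open import Data.List.Base using (List; []; tabulate)
open import Data.Nat.Base using (ℕ; zero; suc; _≤_)
open import Data.Product.Base using (Σ; ∃; ∃-syntax; _×_; _,_)
open import Level using (0ℓ)
open import Relation.Binary.Bundles using (Setoid)
open import Relation.Binary.PropositionalEquality using (_≡_; refl; sym; trans; cong₂)
open import Relation.Unary using (Pred)
import Data.List.Relation.Binary.Permutation.Setoid as SetoidPermutation

record SimpleGraph (n : ℕ) : Set where
  field
    adj       : Fin n → Fin n → Bool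
    symmetric : ∀ u v → adj u v ≡ adj v u
    loopless  : ∀ v → adj v v ≡ false

  Adjacent : Fin n → Fin n → Set
  Adjacent u v = T (adj u v)

open SimpleGraph public

Graph : Set
Graph = ∃ SimpleGraph

infix 4 _≅_

_≅_ : Graph → Graph → Set
(m , G) ≅ (n , H) =
  Σ (Permutation m n) λ π → ∀ u v → adj G u v ≡ adj H (π ⟨$⟩ʳ u) (π ⟨$⟩ʳ v)

≅-refl : ∀ {G} → G ≅ G
≅-refl = id , λ _ _ → refl

≅-sym : ∀ {G H} → G ≅ H → H ≅ G
≅-sym {_ , G} {_ , H} (π , e) = flip π , λ u v →
  sym (trans (e (π ⟨$⟩ˡ u) (π ⟨$⟩ˡ v)) (cong₂ (adj H) (inverseʳ π) (inverseʳ π)))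

≅-trans : ∀ {G H K} → G ≅ H → H ≅ K → G ≅ K
≅-trans (π , e) (ρ , f) =
  π ∘ₚ ρ , λ u v → trans (e u v) (f (π ⟨$⟩ʳ u) (π ⟨$⟩ʳ v))

-- Unlabeled graphs: equality is isomorphism.
≅-setoid : Setoid 0ℓ 0ℓ
≅-setoid = record
  { Carrier       = Graph
  ; _≈_           = _≅_
  ; isEquivalence = record
    { refl  = λ {G} → ≅-refl {G}
    ; sym   = λ {G} {H} → ≅-sym {G} {H}
    ; trans = λ {G} {H} {K} → ≅-trans {G} {H} {K}
    }
  }

Dominating : ∀ {n} → SimpleGraph n → Subset n → Set
Dominating G S = ∀ v → v ∉ S → ∃[ u ] u ∈ S × Adjacent G v u

-- γ(G) = k, i.e. k is the minimum size of a dominating set.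
γ[_]≡_ : ∀ {n} → SimpleGraph n → ℕ → Set
γ[ G ]≡ k = (∃[ S ] Dominating G S × ∣ S ∣ ≡ k)
          × (∀ S → Dominating G S → k ≤ ∣ S ∣)

-- `punchIn v` enumerates the vertices other than v.
delete : ∀ {n} → SimpleGraph (suc n) → Fin (suc n) → SimpleGraph n
delete G v = record
  { adj       = λ i j → adj G (punchIn v i) (punchIn v j)
  ; symmetric = λ i j → symmetric G (punchIn v i) (punchIn v j)
  ; loopless  = λ i → loopless G (punchIn v i)
  }

deck : Graph → List Graph
deck (zero  , G) = []
deck (suc n , G) = tabulate λ v → n , delete G v

-- Equality of decks as multisets of unlabeled graphs: the lists agree up to
-- reordering and replacing cards by isomorphic ones.
infix 4 _≈ᴰ_

_≈ᴰ_ : List Graph → List Graph → Set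
_≈ᴰ_ = SetoidPermutation._↭_ ≅-setoid

_IsReconstructionOf_ : Graph → Graph → Set
H IsReconstructionOf G = deck H ≈ᴰ deck G

Recognizable : Pred Graph 0ℓ → Set
Recognizable 𝓕 = ∀ G H → 𝓕 G → H IsReconstructionOf G → 𝓕 H

𝓗 : Pred Graph 0ℓ
𝓗 (n , G) = 12 ≤ n × γ[ G ]≡ 2

{-# OPTIONS --safe #-}

-- Let N(j) be the number of k-subsets of V(G) that leave exactly j vertices
-- undominated.  Deleting a vertex v outside a k-subset S lowers the number of
-- vertices S leaves undominated by one if v is undominated, and keeps it
-- otherwise.  Hence the cards contain (n − k − j) N(j) + (j + 1) N(j + 1)
-- k-subsets leaving j vertices undominated, so these numbers are determined by
-- the deck.  If G and H have the same deck, the differences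
-- d(j) = N_G(j) − N_H(j) therefore satisfy d(j) = (−1)^j C(n − k, j) d(0).
-- If G had a dominating k-subset and H had none, then d(0) ≥ 1 and
-- N_G(4) ≥ C(n − k, 4), which exceeds the number of all k-subsets when k ≤ 2
-- and n ≥ 12.  The case k = 2 gives γ(H) ≤ 2; the case k = 1 with G and H
-- exchanged gives γ(H) ≥ 2.
module Submission where

open import Defs

import Algebra.Properties.CommutativeSemigroup
import Algebra.Properties.Semiring.Sum
open import Data.Bool.Base as Bool using (if_then_else_)
open import Data.Bool.Properties using (T?)
open import Data.Fin.Base using (Fin; zero; suc; punchIn; punchOut)
open import Data.Fin.Permutation using (Permutation; remove; refute; punchIn-permute; _⟨$⟩ʳ_; _⟨$⟩ˡ_; inverseʳ)
open import Data.Fin.Properties using (all?; any?; punchIn-punchOut) renaming (_≟_ to _≟ᶠ_)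
open import Data.Fin.Subset using (Subset; inside; outside; ∣_∣; _∈_; _∉_)
open import Data.Fin.Subset.Properties using (_∈?_)
open import Data.List.Base using ([]; _∷_; length; map; tabulate)
open import Data.List.Properties using (length-tabulate)
open import Data.List.Relation.Binary.Pointwise.Base using (Pointwise; []; _∷_)
open import Data.List.Relation.Binary.Permutation.Homogeneous using (refl; prep; swap; trans)
open import Data.Nat.Base using (ℕ; zero; suc; _+_; _*_; _∸_; _^_; _≤_; _<_; z≤n; s≤s; >-nonZero)
open import Data.Nat.ListAction using () renaming (sum to sumᴸ)
open import Data.Nat.Properties
open import Data.Nat.Tactic.RingSolver using (solve-∀)
open import Data.Product.Base using (∃-syntax; _×_; _,_; proj₁)
open import Data.Vec.Base using ([]; _∷_; lookup; insertAt)
open import Data.Vec.Properties using ([]=⇒lookup; lookup⇒[]=; insertAt-lookup; insertAt-punchIn)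
open import Function.Base using (_∘_; case_of_)
open import Function.Bundles using (_⇔_; mk⇔)
open import Relation.Binary.PropositionalEquality as ≡ using (_≡_; _≢_; cong; cong₂; sym; subst; module ≡-Reasoning)
open import Relation.Nullary.Decidable using (Dec; yes; no; does; does-⇔; ¬?; _×-dec_; _→-dec_)
open import Relation.Nullary.Negation using (¬_; contradiction)
import Data.List.Relation.Binary.Permutation.Setoid ≅-setoid as ↭
import Data.List.Relation.Binary.Permutation.Setoid.Properties ≅-setoid as ↭ₚ

open Algebra.Properties.CommutativeSemigroup +-commutativeSemigroup using (interchange; x∙yz≈y∙xz)
open Algebra.Properties.Semiring.Sum +-*-semiring
  using (sum; sum-cong-≗; sum-remove; sum-permute; ∑-distrib-+; *-distribʳ-sum)

-- Indicators

𝟙 : {A : Set} → Dec A → ℕ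
𝟙 a? = if does a? then 1 else 0

module _ {A : Set} where

  𝟙-true : (a? : Dec A) → A → 𝟙 a? ≡ 1
  𝟙-true (yes _) _ = ≡.refl
  𝟙-true (no ¬a) a = contradiction a ¬a

  𝟙-false : (a? : Dec A) → ¬ A → 𝟙 a? ≡ 0
  𝟙-false (yes a) ¬a = contradiction a ¬a
  𝟙-false (no _)  _  = ≡.refl

  𝟙-true⁻¹ : (a? : Dec A) → 0 < 𝟙 a? → A
  𝟙-true⁻¹ (yes a) _ = a

  𝟙≤1 : (a? : Dec A) → 𝟙 a? ≤ 1
  𝟙≤1 (yes _) = ≤-refl
  𝟙≤1 (no _)  = z≤n

  *-𝟙-cong : (a? : Dec A) {x y : ℕ} → (A → x ≡ y) → x * 𝟙 a? ≡ y * 𝟙 a?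
  *-𝟙-cong (yes a) x≡y = cong (_* 1) (x≡y a)
  *-𝟙-cong (no _) {x} {y} _ = ≡.trans (*-zeroʳ x) (sym (*-zeroʳ y))

module _ {A B : Set} where

  𝟙-cong : A ⇔ B → (a? : Dec A) (b? : Dec B) → 𝟙 a? ≡ 𝟙 b?
  𝟙-cong A⇔B a? b? = cong (if_then 1 else 0) (does-⇔ A⇔B a? b?)

  -- With `A` read as "in S" and `B` as "undominated by S", a vertex lies in S, is undominated, or
  -- is dominated from outside S, and these exclude one another.
  𝟙-trichotomy : (b? : Dec B) (a? : Dec A) → (B → ¬ A) →
                 𝟙 (¬? a? ×-dec ¬? b?) + (𝟙 b? + 𝟙 a?) ≡ 1
  𝟙-trichotomy (yes b) (yes a) b→¬a = contradiction a (b→¬a b)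
  𝟙-trichotomy (yes _) (no _)  _    = ≡.refl
  𝟙-trichotomy (no _)  (yes _) _    = ≡.refl
  𝟙-trichotomy (no _)  (no _)  _    = ≡.refl

  -- Separates the vertices outside S into dominated and undominated ones. The argument of `F` is
  -- the drop in the undominated count caused by deleting the vertex.
  𝟙-split : (F : ℕ → ℕ) (b? : Dec B) (a? : Dec A) → (B → ¬ A) →
            𝟙 (¬? a?) * F (𝟙 b?) ≡ 𝟙 (¬? a? ×-dec ¬? b?) * F 0 + 𝟙 b? * F 1
  𝟙-split F (yes b) (yes a) b→¬a = contradiction a (b→¬a b)
  𝟙-split F (yes _) (no _)  _    = ≡.refl
  𝟙-split F (no _)  (yes _) _    = ≡.refl
  𝟙-split F (no _)  (no _)  _    = sym (+-identityʳ _)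

-- Sums over a finite set and over its subsets

sum-ones : ∀ n → sum {n} (λ _ → 1) ≡ n
sum-ones zero    = ≡.refl
sum-ones (suc n) = cong suc (sum-ones n)

sum-0⁺ : ∀ {n} {f : Fin n → ℕ} → (∀ i → f i ≡ 0) → sum f ≡ 0
sum-0⁺ {zero}  f≡0 = ≡.refl
sum-0⁺ {suc n} f≡0 = cong₂ _+_ (f≡0 zero) (sum-0⁺ (f≡0 ∘ suc))

sum-0⁻ : ∀ {n} {f : Fin n → ℕ} → sum f ≡ 0 → ∀ i → f i ≡ 0
sum-0⁻         s≡0 zero    = m+n≡0⇒m≡0 _ s≡0
sum-0⁻ {f = f} s≡0 (suc i) = sum-0⁻ (m+n≡0⇒n≡0 (f zero) s≡0) i

∑⊆ : ∀ {n} → (Subset n → ℕ) → ℕ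
∑⊆ {zero}  f = f []
∑⊆ {suc n} f = ∑⊆ (f ∘ (outside ∷_)) + ∑⊆ (f ∘ (inside ∷_))

∑⊆-cong : ∀ {n} {f g : Subset n → ℕ} → (∀ S → f S ≡ g S) → ∑⊆ f ≡ ∑⊆ g
∑⊆-cong {zero}  f≗g = f≗g []
∑⊆-cong {suc n} f≗g = cong₂ _+_ (∑⊆-cong (f≗g ∘ (outside ∷_))) (∑⊆-cong (f≗g ∘ (inside ∷_)))

∑⊆-mono : ∀ {n} {f g : Subset n → ℕ} → (∀ S → f S ≤ g S) → ∑⊆ f ≤ ∑⊆ g
∑⊆-mono {zero}  f≤g = f≤g []
∑⊆-mono {suc n} f≤g = +-mono-≤ (∑⊆-mono (f≤g ∘ (outside ∷_))) (∑⊆-mono (f≤g ∘ (inside ∷_)))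

∑⊆-zero : ∀ n → ∑⊆ {n} (λ _ → 0) ≡ 0
∑⊆-zero zero    = ≡.refl
∑⊆-zero (suc n) = cong₂ _+_ (∑⊆-zero n) (∑⊆-zero n)

∑⊆-distrib-+ : ∀ {n} (f g : Subset n → ℕ) → ∑⊆ (λ S → f S + g S) ≡ ∑⊆ f + ∑⊆ g
∑⊆-distrib-+ {zero}  f g = ≡.refl
∑⊆-distrib-+ {suc n} f g = ≡.trans
  (cong₂ _+_ (∑⊆-distrib-+ (f ∘ (outside ∷_)) (g ∘ (outside ∷_)))
             (∑⊆-distrib-+ (f ∘ (inside ∷_)) (g ∘ (inside ∷_))))
  (interchange (∑⊆ (f ∘ (outside ∷_))) _ _ _)

*-distribˡ-∑⊆ : ∀ {n} c (f : Subset n → ℕ) → ∑⊆ (λ S → c * f S) ≡ c * ∑⊆ f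
*-distribˡ-∑⊆ {zero}  c f = ≡.refl
*-distribˡ-∑⊆ {suc n} c f = ≡.trans
  (cong₂ _+_ (*-distribˡ-∑⊆ c (f ∘ (outside ∷_))) (*-distribˡ-∑⊆ c (f ∘ (inside ∷_))))
  (sym (*-distribˡ-+ c _ _))

sum-∑⊆-comm : ∀ {m n} (f : Fin m → Subset n → ℕ) →
              sum (λ v → ∑⊆ (f v)) ≡ ∑⊆ (λ S → sum (λ v → f v S))
sum-∑⊆-comm {n = zero}  f = ≡.refl
sum-∑⊆-comm {n = suc n} f = ≡.trans
  (∑-distrib-+ (λ v → ∑⊆ (f v ∘ (outside ∷_))) (λ v → ∑⊆ (f v ∘ (inside ∷_))))
  (cong₂ _+_ (sum-∑⊆-comm (λ v → f v ∘ (outside ∷_))) (sum-∑⊆-comm (λ v → f v ∘ (inside ∷_))))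

∑⊆-positive⁺ : ∀ {n} (f : Subset n → ℕ) S → 0 < f S → 0 < ∑⊆ f
∑⊆-positive⁺ f []            0<fS = 0<fS
∑⊆-positive⁺ f (outside ∷ S) 0<fS = m≤n⇒m≤n+o _ (∑⊆-positive⁺ (f ∘ (outside ∷_)) S 0<fS)
∑⊆-positive⁺ f (inside ∷ S)  0<fS = m≤n⇒m≤o+n _ (∑⊆-positive⁺ (f ∘ (inside ∷_)) S 0<fS)

∑⊆-positive⁻ : ∀ {n} (f : Subset n → ℕ) → 0 < ∑⊆ f → ∃[ S ] 0 < f S
∑⊆-positive⁻ {zero}  f 0<f = [] , 0<f
∑⊆-positive⁻ {suc n} f 0<∑ with ∑⊆ (f ∘ (outside ∷_)) in eq
... | suc _ = let S , 0<fS = ∑⊆-positive⁻ (f ∘ (outside ∷_)) (subst (0 <_) (sym eq) (s≤s z≤n))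
              in outside ∷ S , 0<fS
... | zero  = let S , 0<fS = ∑⊆-positive⁻ (f ∘ (inside ∷_)) 0<∑ in inside ∷ S , 0<fS

-- Splits on membership of an arbitrary vertex `v`, so that subsets avoiding `v` can be matched with
-- subsets of the card at `v`.
∑⊆-insertAt : ∀ {n} (v : Fin (suc n)) (f : Subset (suc n) → ℕ) →
              ∑⊆ f ≡ ∑⊆ (λ S → f (insertAt S v outside)) + ∑⊆ (λ S → f (insertAt S v inside))
∑⊆-insertAt zero f = ≡.refl
∑⊆-insertAt {suc n} (suc v) f = ≡.trans
  (cong₂ _+_ (∑⊆-insertAt v (f ∘ (outside ∷_))) (∑⊆-insertAt v (f ∘ (inside ∷_))))
  (interchange (∑⊆ (λ S → f (outside ∷ insertAt S v outside))) _ _ _)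

-- Relating S and T pointwise avoids constructing the image of a subset. The induction removes
-- vertex zero from one side and its image under `π` from the other.
∑⊆-permute : ∀ {m n} (π : Permutation m n) {f : Subset m → ℕ} {g : Subset n → ℕ} →
             (∀ S T → (∀ i → lookup S i ≡ lookup T (π ⟨$⟩ʳ i)) → f S ≡ g T) →
             ∑⊆ f ≡ ∑⊆ g
∑⊆-permute {zero}  {zero}  π f≗g = f≗g [] [] λ ()
∑⊆-permute {zero}  {suc n} π f≗g = contradiction π (refute λ ())
∑⊆-permute {suc m} {zero}  π f≗g = contradiction π (refute λ ())
∑⊆-permute {suc m} {suc n} π {f} {g} f≗g = ≡.trans
  (cong₂ _+_ (half outside) (half inside))
  (sym (∑⊆-insertAt (π ⟨$⟩ʳ zero) g))
  where
  half : ∀ b → ∑⊆ (λ S → f (b ∷ S)) ≡ ∑⊆ (λ T → g (insertAt T (π ⟨$⟩ʳ zero) b))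
  half b = ∑⊆-permute (remove zero π) λ S T S∼T → f≗g _ _ λ where
    zero    → sym (insertAt-lookup T (π ⟨$⟩ʳ zero) b)
    (suc i) → ≡.trans (S∼T i) (≡.trans
      (sym (insertAt-punchIn T (π ⟨$⟩ʳ zero) b _))
      (cong (lookup (insertAt T (π ⟨$⟩ʳ zero) b)) (sym (punchIn-permute π zero i))))

-- Cardinalities of subsets

∣∣≡sum : ∀ {n} (S : Subset n) → ∣ S ∣ ≡ sum (λ v → 𝟙 (v ∈? S))
∣∣≡sum []            = ≡.refl
∣∣≡sum (outside ∷ S) = ∣∣≡sum S
∣∣≡sum (inside ∷ S)  = cong suc (∣∣≡sum S)

∣insertAt-outside∣ : ∀ {n} (S : Subset n) v → ∣ insertAt S v outside ∣ ≡ ∣ S ∣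
∣insertAt-outside∣ S             zero    = ≡.refl
∣insertAt-outside∣ (outside ∷ S) (suc v) = ∣insertAt-outside∣ S v
∣insertAt-outside∣ (inside ∷ S)  (suc v) = cong suc (∣insertAt-outside∣ S v)

∈-cong : ∀ {m n} {S : Subset m} {T : Subset n} {i j} → lookup S i ≡ lookup T j → i ∈ S → j ∈ T
∈-cong {T = T} {j = j} eq i∈S = lookup⇒[]= j T (≡.trans (sym eq) ([]=⇒lookup i∈S))

#ofSize : ℕ → ℕ → ℕ
#ofSize n k = ∑⊆ {n} (λ S → 𝟙 (∣ S ∣ ≟ k))

-- Pascal's rule drives the induction. The power is a crude substitute for the binomial coefficient,
-- sufficient for the final estimates.
#ofSize≤^ : ∀ n k → #ofSize n k ≤ n ^ k
#ofSize≤^ zero    zero    = ≤-refl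
#ofSize≤^ zero    (suc k) = z≤n
#ofSize≤^ (suc n) zero    = ≤-trans
  (≤-reflexive (≡.trans (cong (#ofSize n 0 +_) (∑⊆-zero n)) (+-identityʳ _)))
  (#ofSize≤^ n 0)
#ofSize≤^ (suc n) (suc k) = begin
  #ofSize n (suc k) + #ofSize n k  ≤⟨ +-mono-≤ (#ofSize≤^ n (suc k)) (#ofSize≤^ n k) ⟩
  n * n ^ k + n ^ k                ≡⟨ +-comm (n * n ^ k) _ ⟩
  suc n * n ^ k                    ≤⟨ *-monoʳ-≤ (suc n) (^-monoˡ-≤ k (n≤1+n n)) ⟩
  suc n * suc n ^ k                ∎
  where open ≤-Reasoning

-- Undominated vertices

Undominated : ∀ {n} → SimpleGraph n → Subset n → Fin n → Set
Undominated G S v = v ∉ S × (∀ u → u ∈ S → ¬ Adjacent G v u)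

undominated? : ∀ {n} (G : SimpleGraph n) S v → Dec (Undominated G S v)
undominated? G S v = ¬? (v ∈? S) ×-dec all? (λ u → (u ∈? S) →-dec ¬? (T? (adj G v u)))

-- Serves both isomorphisms and the embedding of a card. Only neighbours in T can dominate, so the
-- image of `f` has to cover T but not every vertex.
Undominated-cong : ∀ {m n} (G : SimpleGraph m) (H : SimpleGraph n) {S T} (f : Fin m → Fin n) →
                   (∀ u v → adj G u v ≡ adj H (f u) (f v)) →
                   (∀ u → lookup S u ≡ lookup T (f u)) →
                   (∀ w → w ∈ T → ∃[ u ] f u ≡ w) →
                   ∀ v → Undominated G S v ⇔ Undominated H T (f v)
Undominated-cong G H {S} {T} f adj≡ S∼T T⊆im v = mk⇔
  (λ (v∉S , ¬adj) → v∉S ∘ ∈-cong (sym (S∼T v)) , λ w w∈T fv~w →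
    case T⊆im w w∈T of λ where
      (u , ≡.refl) → ¬adj u (∈-cong (sym (S∼T u)) w∈T) (subst Bool.T (sym (adj≡ v u)) fv~w))
  (λ (fv∉T , ¬adj) → fv∉T ∘ ∈-cong (S∼T v) , λ u u∈S v~u →
    ¬adj (f u) (∈-cong (S∼T u) u∈S) (subst Bool.T (adj≡ v u) v~u))

#undominated : ∀ {n} → SimpleGraph n → Subset n → ℕ
#undominated G S = sum (λ v → 𝟙 (undominated? G S v))

dominating⇒#undominated≡0 : ∀ {n} (G : SimpleGraph n) S → Dominating G S → #undominated G S ≡ 0
dominating⇒#undominated≡0 G S dom = sum-0⁺ λ v → 𝟙-false (undominated? G S v) λ (v∉S , ¬adj) →
  let u , u∈S , v~u = dom v v∉S in ¬adj u u∈S v~u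

#undominated≡0⇒dominating : ∀ {n} (G : SimpleGraph n) S → #undominated G S ≡ 0 → Dominating G S
#undominated≡0⇒dominating G S none v v∉S with any? (λ u → (u ∈? S) ×-dec T? (adj G v u))
... | yes witness = witness
... | no ¬witness = contradiction
  (≡.trans (sym (𝟙-true (undominated? G S v) (v∉S , λ u u∈S v~u → ¬witness (u , u∈S , v~u))))
           (sum-0⁻ none v))
  λ ()

module _ {m n} (G : SimpleGraph m) (H : SimpleGraph n) (π : Permutation m n)
         (adj≡ : ∀ u v → adj G u v ≡ adj H (π ⟨$⟩ʳ u) (π ⟨$⟩ʳ v))
         (S : Subset m) (T : Subset n) (S∼T : ∀ i → lookup S i ≡ lookup T (π ⟨$⟩ʳ i)) where

  ∣∣-permute : ∣ S ∣ ≡ ∣ T ∣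
  ∣∣-permute = begin
    ∣ S ∣                               ≡⟨ ∣∣≡sum S ⟩
    sum (λ i → 𝟙 (i ∈? S))              ≡⟨ sum-cong-≗ (λ i → 𝟙-cong (mk⇔ (∈-cong (S∼T i)) (∈-cong (sym (S∼T i)))) (i ∈? S) (π ⟨$⟩ʳ i ∈? T)) ⟩
    sum (λ i → 𝟙 (π ⟨$⟩ʳ i ∈? T))       ≡⟨ sum-permute (λ j → 𝟙 (j ∈? T)) π ⟨
    sum (λ j → 𝟙 (j ∈? T))              ≡⟨ ∣∣≡sum T ⟨
    ∣ T ∣                               ∎
    where open ≡-Reasoning

  #undominated-permute : #undominated G S ≡ #undominated H T
  #undominated-permute = ≡.trans
    (sum-cong-≗ λ i → 𝟙-cong
      (Undominated-cong G H (π ⟨$⟩ʳ_) adj≡ S∼T (λ w _ → π ⟨$⟩ˡ w , inverseʳ π) i)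
      (undominated? G S i) (undominated? H T (π ⟨$⟩ʳ i)))
    (sym (sum-permute (λ j → 𝟙 (undominated? H T j)) π))

-- Since `v` is not in `S⁺`, it dominates no other vertex; its deletion removes only its own
-- contribution.
#undominated-delete : ∀ {n} (G : SimpleGraph (suc n)) v S → let S⁺ = insertAt S v outside in
                      #undominated G S⁺ ≡ 𝟙 (undominated? G S⁺ v) + #undominated (delete G v) S
#undominated-delete G v S = ≡.trans
  (sum-remove {i = v} (λ w → 𝟙 (undominated? G S⁺ w)))
  (cong (𝟙 (undominated? G S⁺ v) +_) (sum-cong-≗ λ i → sym (𝟙-cong
    (Undominated-cong (delete G v) G (punchIn v) (λ _ _ → ≡.refl)
      (λ u → sym (insertAt-punchIn S v outside u)) preimage i)
    (undominated? (delete G v) S i) (undominated? G S⁺ (punchIn v i)))))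
  where
  S⁺ = insertAt S v outside
  preimage : ∀ w → w ∈ S⁺ → ∃[ u ] punchIn v u ≡ w
  preimage w w∈S⁺ with v ≟ᶠ w
  ... | no v≢w     = punchOut v≢w , punchIn-punchOut v≢w
  ... | yes ≡.refl = contradiction
    (≡.trans (sym (insertAt-lookup S v outside)) ([]=⇒lookup w∈S⁺)) λ ()

-- Counting k-subsets by the number of vertices they leave undominated

leaves : ∀ {n} → SimpleGraph n → ℕ → ℕ → Subset n → ℕ
leaves G k j S = 𝟙 (∣ S ∣ ≟ k) * 𝟙 (#undominated G S ≟ j)

#leaving : ℕ → ℕ → Graph → ℕ
#leaving k j (_ , G) = ∑⊆ (leaves G k j)

#leaving-≅ : ∀ k j {G H} → G ≅ H → #leaving k j G ≡ #leaving k j H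
#leaving-≅ k j {_ , G} {_ , H} (π , adj≡) = ∑⊆-permute π λ S T S∼T →
  cong₂ (λ s u → 𝟙 (s ≟ k) * 𝟙 (u ≟ j))
    (∣∣-permute G H π adj≡ S T S∼T) (#undominated-permute G H π adj≡ S T S∼T)

#leaving≤^ : ∀ k j {n} (G : SimpleGraph n) → #leaving k j (n , G) ≤ n ^ k
#leaving≤^ k j {n} G = ≤-trans
  (∑⊆-mono λ S → ≤-trans (*-monoʳ-≤ (𝟙 (∣ S ∣ ≟ k)) (𝟙≤1 (#undominated G S ≟ j)))
                         (≤-reflexive (*-identityʳ _)))
  (#ofSize≤^ n k)

dominating⇒#leaving : ∀ {n} (G : SimpleGraph n) S → Dominating G S → 0 < #leaving ∣ S ∣ 0 (n , G)
dominating⇒#leaving G S dom = ∑⊆-positive⁺ (leaves G ∣ S ∣ 0) S (≤-reflexive (sym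
  (cong₂ _*_ (𝟙-true (∣ S ∣ ≟ ∣ S ∣) ≡.refl)
             (𝟙-true (#undominated G S ≟ 0) (dominating⇒#undominated≡0 G S dom)))))

#leaving⇒dominating : ∀ k {n} (G : SimpleGraph n) → 0 < #leaving k 0 (n , G) →
                      ∃[ S ] Dominating G S × ∣ S ∣ ≡ k
#leaving⇒dominating k G 0<N =
  let S , 0<fS = ∑⊆-positive⁻ (leaves G k 0) 0<N
      s? = ∣ S ∣ ≟ k
      u? = #undominated G S ≟ 0
  in S , #undominated≡0⇒dominating G S (𝟙-true⁻¹ u? (n≢0⇒n>0 λ u≡0 →
           <⇒≢ 0<fS (sym (≡.trans (cong (𝟙 s? *_) u≡0) (*-zeroʳ (𝟙 s?))))))
       , 𝟙-true⁻¹ s? (n≢0⇒n>0 λ s≡0 → <⇒≢ 0<fS (sym (cong (_* 𝟙 u?) s≡0)))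

-- The contribution of S to the count on the card at `v`, expressed in `G` alone. This lets S be
-- fixed while `v` varies.
cardTerm : ∀ {n} → SimpleGraph n → ℕ → ℕ → Fin n → Subset n → ℕ
cardTerm G k j v S =
  𝟙 (¬? (v ∈? S)) * (𝟙 (∣ S ∣ ≟ k) * 𝟙 (#undominated G S ≟ 𝟙 (undominated? G S v) + j))

#leaving-delete : ∀ k j {n} (G : SimpleGraph (suc n)) v →
                  #leaving k j (n , delete G v) ≡ ∑⊆ (cardTerm G k j v)
#leaving-delete k j {n} G v = sym (begin
  ∑⊆ (cardTerm G k j v)
    ≡⟨ ∑⊆-insertAt v (cardTerm G k j v) ⟩
  ∑⊆ (λ S → cardTerm G k j v (insertAt S v outside)) + ∑⊆ (λ S → cardTerm G k j v (insertAt S v inside))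
    ≡⟨ cong₂ _+_ (∑⊆-cong avoiding) (≡.trans (∑⊆-cong containing) (∑⊆-zero n)) ⟩
  #leaving k j (n , delete G v) + 0
    ≡⟨ +-identityʳ _ ⟩
  #leaving k j (n , delete G v) ∎)
  where
  open ≡-Reasoning

  containing : ∀ S → cardTerm G k j v (insertAt S v inside) ≡ 0
  containing S = cong₂ _*_ (𝟙-false (¬? (v ∈? insertAt S v inside)) λ v∉ →
    v∉ (lookup⇒[]= v _ (insertAt-lookup S v inside))) ≡.refl

  avoiding : ∀ S → cardTerm G k j v (insertAt S v outside) ≡ leaves (delete G v) k j S
  avoiding S = begin
    𝟙 (¬? (v ∈? S⁺)) * (𝟙 (∣ S⁺ ∣ ≟ k) * 𝟙 (#undominated G S⁺ ≟ x + j))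
      ≡⟨ cong₂ _*_ (𝟙-true (¬? (v ∈? S⁺)) λ v∈ → contradiction
           (≡.trans (sym (insertAt-lookup S v outside)) ([]=⇒lookup v∈)) λ ()) ≡.refl ⟩
    1 * (𝟙 (∣ S⁺ ∣ ≟ k) * 𝟙 (#undominated G S⁺ ≟ x + j))
      ≡⟨ *-identityˡ _ ⟩
    𝟙 (∣ S⁺ ∣ ≟ k) * 𝟙 (#undominated G S⁺ ≟ x + j)
      ≡⟨ cong₂ (λ s u → 𝟙 (s ≟ k) * 𝟙 (u ≟ x + j)) (∣insertAt-outside∣ S v) (#undominated-delete G v S) ⟩
    𝟙 (∣ S ∣ ≟ k) * 𝟙 (x + u ≟ x + j)
      ≡⟨ cong (𝟙 (∣ S ∣ ≟ k) *_) (𝟙-cong (mk⇔ (+-cancelˡ-≡ x u j) (cong (x +_))) (x + u ≟ x + j) (u ≟ j)) ⟩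
    𝟙 (∣ S ∣ ≟ k) * 𝟙 (u ≟ j) ∎
    where
    S⁺ = insertAt S v outside
    x = 𝟙 (undominated? G S⁺ v)
    u = #undominated (delete G v) S

-- Here `p` counts the vertices outside a k-subset. If S leaves `j` undominated, deleting any of the
-- `p ∸ j` dominated vertices outside S keeps that number; if it leaves `suc j`, deleting any of
-- those lowers it to `j`.
sum-cardTerm : ∀ p k j {n} (G : SimpleGraph n) → n ≡ p + k → ∀ S →
               sum (λ v → cardTerm G k j v S) ≡ (p ∸ j) * leaves G k j S + suc j * leaves G k (suc j) S
sum-cardTerm p k j {n} G n≡p+k S = begin
  sum (λ v → cardTerm G k j v S)
    ≡⟨ sum-cong-≗ (λ v → 𝟙-split (λ x → 𝟙 s? * 𝟙 (u ≟ x + j)) (undominated? G S v) (v ∈? S) proj₁) ⟩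
  sum (λ v → rest v * leaves G k j S + undom v * leaves G k (suc j) S)
    ≡⟨ ∑-distrib-+ (λ v → rest v * leaves G k j S) (λ v → undom v * leaves G k (suc j) S) ⟩
  sum (λ v → rest v * leaves G k j S) + sum (λ v → undom v * leaves G k (suc j) S)
    ≡⟨ cong₂ _+_ (*-distribʳ-sum (leaves G k j S) rest) (*-distribʳ-sum (leaves G k (suc j) S) undom) ⟨
  r * leaves G k j S + u * leaves G k (suc j) S
    ≡⟨ cong₂ _+_ (on-leaves j r≡p∸j) (on-leaves (suc j) λ _ u≡ → u≡) ⟩
  (p ∸ j) * leaves G k j S + suc j * leaves G k (suc j) S ∎
  where
  open ≡-Reasoning
  s? = ∣ S ∣ ≟ k
  undom rest : Fin n → ℕ
  undom v = 𝟙 (undominated? G S v)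
  rest  v = 𝟙 (¬? (v ∈? S) ×-dec ¬? (undominated? G S v))
  u = #undominated G S
  r = sum rest

  -- The coefficients have to agree only where `leaves` is nonzero; elsewhere both products vanish.
  on-leaves : ∀ i {x y} → (∣ S ∣ ≡ k → u ≡ i → x ≡ y) → x * leaves G k i S ≡ y * leaves G k i S
  on-leaves i {x} {y} x≡y = begin
    x * (𝟙 s? * 𝟙 (u ≟ i))  ≡⟨ *-assoc x _ _ ⟨
    x * 𝟙 s? * 𝟙 (u ≟ i)    ≡⟨ *-𝟙-cong (u ≟ i) (λ u≡i → *-𝟙-cong s? (λ s≡k → x≡y s≡k u≡i)) ⟩
    y * 𝟙 s? * 𝟙 (u ≟ i)    ≡⟨ *-assoc y _ _ ⟩
    y * (𝟙 s? * 𝟙 (u ≟ i))  ∎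

  r+u+∣S∣≡n : r + (u + ∣ S ∣) ≡ n
  r+u+∣S∣≡n = begin
    r + (u + ∣ S ∣)                                     ≡⟨ cong (λ s → r + (u + s)) (∣∣≡sum S) ⟩
    r + (u + sum (λ v → 𝟙 (v ∈? S)))                    ≡⟨ cong (r +_) (∑-distrib-+ undom (λ v → 𝟙 (v ∈? S))) ⟨
    r + sum (λ v → undom v + 𝟙 (v ∈? S))                ≡⟨ ∑-distrib-+ rest (λ v → undom v + 𝟙 (v ∈? S)) ⟨
    sum (λ v → rest v + (undom v + 𝟙 (v ∈? S)))         ≡⟨ sum-cong-≗ (λ v → 𝟙-trichotomy (undominated? G S v) (v ∈? S) proj₁) ⟩
    sum {n} (λ _ → 1)                                   ≡⟨ sum-ones n ⟩
    n                                                   ∎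

  -- The count gives `r + j ≡ p`, so the truncated subtraction is exact here.
  r≡p∸j : ∣ S ∣ ≡ k → u ≡ j → r ≡ p ∸ j
  r≡p∸j s≡k u≡j = begin
    r          ≡⟨ m+n∸n≡m r j ⟨
    r + j ∸ j  ≡⟨ cong (_∸ j) (+-cancelʳ-≡ k (r + j) p (begin
      r + j + k        ≡⟨ +-assoc r j k ⟩
      r + (j + k)      ≡⟨ cong₂ (λ a b → r + (a + b)) u≡j s≡k ⟨
      r + (u + ∣ S ∣)  ≡⟨ r+u+∣S∣≡n ⟩
      n                ≡⟨ n≡p+k ⟩
      p + k            ∎)) ⟩
    p ∸ j      ∎

-- Double counting of pairs of a card and a k-subset: the sum over cards is exchanged with the sum
-- over subsets of `G`.
sum-#leaving-delete : ∀ p k j {n} (G : SimpleGraph (suc n)) → suc n ≡ p + k →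
                      sum (λ v → #leaving k j (n , delete G v))
                      ≡ (p ∸ j) * #leaving k j (suc n , G) + suc j * #leaving k (suc j) (suc n , G)
sum-#leaving-delete p k j {n} G n≡p+k = begin
  sum (λ v → #leaving k j (n , delete G v))
    ≡⟨ sum-cong-≗ (#leaving-delete k j G) ⟩
  sum (λ v → ∑⊆ (cardTerm G k j v))
    ≡⟨ sum-∑⊆-comm (cardTerm G k j) ⟩
  ∑⊆ (λ S → sum (λ v → cardTerm G k j v S))
    ≡⟨ ∑⊆-cong (sum-cardTerm p k j G n≡p+k) ⟩
  ∑⊆ (λ S → (p ∸ j) * leaves G k j S + suc j * leaves G k (suc j) S)
    ≡⟨ ∑⊆-distrib-+ (λ S → (p ∸ j) * leaves G k j S) (λ S → suc j * leaves G k (suc j) S) ⟩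
  ∑⊆ (λ S → (p ∸ j) * leaves G k j S) + ∑⊆ (λ S → suc j * leaves G k (suc j) S)
    ≡⟨ cong₂ _+_ (*-distribˡ-∑⊆ (p ∸ j) (leaves G k j)) (*-distribˡ-∑⊆ (suc j) (leaves G k (suc j))) ⟩
  (p ∸ j) * #leaving k j (suc n , G) + suc j * #leaving k (suc j) (suc n , G) ∎
  where open ≡-Reasoning

-- Decks

length-deck : ∀ {n} (G : SimpleGraph n) → length (deck (n , G)) ≡ n
length-deck {zero}  G = ≡.refl
length-deck {suc n} G = length-tabulate (λ v → n , delete G v)

module _ (f : Graph → ℕ) where

  sum-tabulate : ∀ {n} (g : Fin n → Graph) → sumᴸ (map f (tabulate g)) ≡ sum (f ∘ g)
  sum-tabulate {zero}  g = ≡.refl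
  sum-tabulate {suc n} g = cong (f (g zero) +_) (sum-tabulate (g ∘ suc))

  module _ (f-cong : ∀ {G H} → G ≅ H → f G ≡ f H) where

    sum-Pointwise : ∀ {xs ys} → Pointwise _≅_ xs ys → sumᴸ (map f xs) ≡ sumᴸ (map f ys)
    sum-Pointwise []                 = ≡.refl
    sum-Pointwise (_∷_ {x} {y} e es) = cong₂ _+_ (f-cong {x} {y} e) (sum-Pointwise es)

    sum-≈ᴰ : ∀ {xs ys} → xs ≈ᴰ ys → sumᴸ (map f xs) ≡ sumᴸ (map f ys)
    sum-≈ᴰ (refl es) = sum-Pointwise es
    sum-≈ᴰ (prep {x = x} {y} e p) = cong₂ _+_ (f-cong {x} {y} e) (sum-≈ᴰ p)
    sum-≈ᴰ (swap {x = x} {y} {x′} {y′} e₁ e₂ p) = ≡.trans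
      (cong₂ _+_ (f-cong {x} {x′} e₁) (cong₂ _+_ (f-cong {y} {y′} e₂) (sum-≈ᴰ p)))
      (x∙yz≈y∙xz (f x′) (f y′) _)
    sum-≈ᴰ (trans p q) = ≡.trans (sum-≈ᴰ p) (sum-≈ᴰ q)

-- Comparing two graphs with the same deck

#leaving-deck : ∀ p k j {n} (G H : SimpleGraph (suc n)) → suc n ≡ p + k →
                deck (suc n , G) ≈ᴰ deck (suc n , H) →
                (p ∸ j) * #leaving k j (suc n , G) + suc j * #leaving k (suc j) (suc n , G)
                ≡ (p ∸ j) * #leaving k j (suc n , H) + suc j * #leaving k (suc j) (suc n , H)
#leaving-deck p k j {n} G H n≡p+k G≈H = begin
  _                                          ≡⟨ sum-#leaving-delete p k j G n≡p+k ⟨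
  sum (λ v → N (n , delete G v))             ≡⟨ sum-tabulate N (λ v → n , delete G v) ⟨
  sumᴸ (map N (deck (suc n , G)))            ≡⟨ sum-≈ᴰ N (λ {X} {Y} → #leaving-≅ k j {X} {Y}) G≈H ⟩
  sumᴸ (map N (deck (suc n , H)))            ≡⟨ sum-tabulate N (λ v → n , delete H v) ⟩
  sum (λ v → N (n , delete H v))             ≡⟨ sum-#leaving-delete p k j H n≡p+k ⟩
  _                                          ∎
  where
  open ≡-Reasoning
  N = #leaving k j

-- One step d(j) ↦ d(j + 1), where e is the current difference scaled by c; the
-- sides swap because the differences alternate in sign.
difference-step : ∀ (f g : ℕ → ℕ) j a c e →
                  a * f j + suc j * f (suc j) ≡ a * g j + suc j * g (suc j) →
                  c * f j ≡ c * g j + e →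
                  (c * suc j) * g (suc j) ≡ (c * suc j) * f (suc j) + a * e
difference-step f g j a c e rec cf≡cg+e = +-cancelˡ-≡ (a * (c * g j)) _ _ (begin
  a * (c * g j) + c * suc j * g (suc j)            ≡⟨ expand a (suc j) c (g j) (g (suc j)) ⟨
  c * (a * g j + suc j * g (suc j))                ≡⟨ cong (c *_) rec ⟨
  c * (a * f j + suc j * f (suc j))                ≡⟨ expand a (suc j) c (f j) (f (suc j)) ⟩
  a * (c * f j) + c * suc j * f (suc j)            ≡⟨ cong (λ z → a * z + c * suc j * f (suc j)) cf≡cg+e ⟩
  a * (c * g j + e) + c * suc j * f (suc j)        ≡⟨ regroup a (c * g j) e (c * suc j * f (suc j)) ⟩
  a * (c * g j) + (c * suc j * f (suc j) + a * e)  ∎)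
  where
  open ≡-Reasoning
  expand : ∀ a b c x x′ → c * (a * x + b * x′) ≡ a * (c * x) + c * b * x′
  expand = solve-∀
  regroup : ∀ a w e z → a * (w + e) + z ≡ a * w + (z + a * e)
  regroup = solve-∀

-- With `4 + q` equal to n - k and 24 = 4!, the size hypothesis says n^k < C(n - k, 4). At n = 12
-- and k = 2 it reads 144 < 210, whereas C(10, 3) = 120 would not beat this crude bound.
dominatingSet-transfer : ∀ q k {n} (G H : SimpleGraph (suc n)) → suc n ≡ 4 + q + k →
  24 * suc n ^ k < (1 + q) * ((2 + q) * ((3 + q) * (4 + q))) →
  deck (suc n , G) ≈ᴰ deck (suc n , H) →
  (∃[ S ] Dominating G S × ∣ S ∣ ≡ k) → ∃[ S ] Dominating H S × ∣ S ∣ ≡ k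
dominatingSet-transfer q k {n} G H n≡p+k large G≈H (S , dom , ≡.refl) =
  #leaving⇒dominating k H (n≢0⇒n>0 λ h0≡0 → <⇒≱ large (begin
    (1 + q) * ((2 + q) * ((3 + q) * (4 + q)))
      -- `g 0` is at least 1 because S itself is counted.
      ≤⟨ *-monoʳ-≤ (1 + q) (*-monoʳ-≤ (2 + q) (*-monoʳ-≤ (3 + q)
           (m≤m*n (4 + q) (g 0) ⦃ >-nonZero (dominating⇒#leaving G S dom) ⦄))) ⟩
    e₄
      ≤⟨ m≤n+m e₄ (24 * h 4) ⟩
    24 * h 4 + e₄
      ≡⟨ 24g₄≡24h₄+e₄ h0≡0 ⟨
    24 * g 4
      ≤⟨ *-monoʳ-≤ 24 (#leaving≤^ k 4 G) ⟩
    24 * suc n ^ k ∎))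
  where
  open ≤-Reasoning
  g h : ℕ → ℕ
  g j = #leaving k j (suc n , G)
  h j = #leaving k j (suc n , H)

  rec : ∀ j → (4 + q ∸ j) * g j + suc j * g (suc j) ≡ (4 + q ∸ j) * h j + suc j * h (suc j)
  rec j = #leaving-deck (4 + q) k j G H n≡p+k G≈H

  e₁ e₂ e₃ e₄ : ℕ
  e₁ = (4 + q) * g 0
  e₂ = (3 + q) * e₁
  e₃ = (2 + q) * e₂
  e₄ = (1 + q) * e₃

  24g₄≡24h₄+e₄ : h 0 ≡ 0 → 24 * g 4 ≡ 24 * h 4 + e₄
  24g₄≡24h₄+e₄ h0≡0 =
    -- Read from the innermost step outwards: the scale is j! = 1, 1, 2, 6, and `g` and `h` exchange
    -- roles each time, so `rec` is reversed for odd j.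
    difference-step h g 3 (1 + q) 6 e₃ (sym (rec 3))
      (difference-step g h 2 (2 + q) 2 e₂ (rec 2)
        (difference-step h g 1 (3 + q) 1 e₁ (sym (rec 1))
          (difference-step g h 0 (4 + q) 1 (g 0) (rec 0)
            (≡.trans (*-identityˡ (g 0)) (cong (λ z → 1 * z + g 0) (sym h0≡0))))))

-- Numerical estimates for k = 1 and k = 2

large₁ : ∀ m → 24 * (12 + m) ^ 1 < (8 + m) * ((9 + m) * ((10 + m) * (11 + m)))
large₁ m = begin-strict
  24 * (12 + m) ^ 1                          ≤⟨ *-monoʳ-≤ 24 12+m≤ ⟩
  24 * ((8 + m) * 2)                         ≡⟨ regroup (8 + m) ⟩
  (8 + m) * 48                               <⟨ *-monoʳ-< (8 + m) 48< ⟩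
  (8 + m) * ((9 + m) * ((10 + m) * (11 + m))) ∎
  where
  open ≤-Reasoning
  regroup : ∀ a → 24 * (a * 2) ≡ a * 48
  regroup = solve-∀
  expand : ∀ m → (12 + m) * 1 + (4 + m) ≡ (8 + m) * 2
  expand = solve-∀
  12+m≤ : (12 + m) ^ 1 ≤ (8 + m) * 2
  12+m≤ = subst ((12 + m) ^ 1 ≤_) (expand m) (m≤m+n _ _)
  48< : 48 < (9 + m) * ((10 + m) * (11 + m))
  48< = <-≤-trans (<ᵇ⇒< 48 990 _) (*-mono-≤ (m≤m+n 9 m) (*-mono-≤ (m≤m+n 10 m) (m≤m+n 11 m)))

-- The two middle factors absorb the square up to a factor 2, with equality at `m = 0`; the outer
-- two have product at least 70 and absorb the remaining 48.
large₂ : ∀ m → 24 * (12 + m) ^ 2 < (7 + m) * ((8 + m) * ((9 + m) * (10 + m)))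
large₂ m = begin-strict
  24 * (12 + m) ^ 2                          ≤⟨ *-monoʳ-≤ 24 square≤ ⟩
  24 * (((8 + m) * (9 + m)) * 2)             ≡⟨ regroup ((8 + m) * (9 + m)) ⟩
  ((8 + m) * (9 + m)) * 48                   <⟨ *-monoʳ-< ((8 + m) * (9 + m)) 48< ⟩
  ((8 + m) * (9 + m)) * ((7 + m) * (10 + m)) ≡⟨ reorder (7 + m) (8 + m) (9 + m) (10 + m) ⟩
  (7 + m) * ((8 + m) * ((9 + m) * (10 + m))) ∎
  where
  open ≤-Reasoning
  regroup : ∀ a → 24 * (a * 2) ≡ a * 48
  regroup = solve-∀
  reorder : ∀ a b c d → (b * c) * (a * d) ≡ a * (b * (c * d))
  reorder = solve-∀
  expand : ∀ m → (12 + m) * ((12 + m) * 1) + (10 * m + m * m) ≡ ((8 + m) * (9 + m)) * 2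
  expand = solve-∀
  square≤ : (12 + m) ^ 2 ≤ ((8 + m) * (9 + m)) * 2
  square≤ = subst ((12 + m) ^ 2 ≤_) (expand m) (m≤m+n _ _)
  48< : 48 < (7 + m) * (10 + m)
  48< = <-≤-trans (<ᵇ⇒< 48 70 _) (*-mono-≤ (m≤m+n 7 m) (m≤m+n 10 m))

-- Domination number two and recognizability

dominating⇒nonempty : ∀ {n} (G : SimpleGraph (suc n)) S → Dominating G S → ∣ S ∣ ≢ 0
dominating⇒nonempty G S dom ∣S∣≡0 = case zero ∈? S of λ where
    (yes 0∈S) → empty zero 0∈S
    (no 0∉S)  → let u , u∈S , _ = dom zero 0∉S in empty u u∈S
  where
  empty : ∀ v → v ∉ S
  empty v v∈S = contradiction
    (≡.trans (sym (𝟙-true (v ∈? S) v∈S)) (sum-0⁻ {f = λ w → 𝟙 (w ∈? S)} (≡.trans (sym (∣∣≡sum S)) ∣S∣≡0) v)) λ ()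

γ≡2-transfer : ∀ m (G H : SimpleGraph (12 + m)) → deck (12 + m , G) ≈ᴰ deck (12 + m , H) →
               γ[ G ]≡ 2 → γ[ H ]≡ 2
γ≡2-transfer m G H G≈H (pair , minimal) =
    -- The parameter `q` is n - k - 4, hence `6 + m` for k = 2 and `7 + m` for k = 1.
    dominatingSet-transfer (6 + m) 2 G H (+-comm 2 (10 + m)) (large₂ m) G≈H pair
  , λ S dom → lower S dom ∣ S ∣ ≡.refl
  where
  lower : ∀ S → Dominating H S → ∀ s → ∣ S ∣ ≡ s → 2 ≤ s
  lower S dom 0 ∣S∣≡0 = contradiction ∣S∣≡0 (dominating⇒nonempty H S dom)
  -- A dominating singleton of `H` would give one of `G`, and minimality in `G` then yields the
  -- absurd goal `2 ≤ 1`.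
  lower S dom 1 ∣S∣≡1 =
    let S′ , dom′ , ∣S′∣≡1 = dominatingSet-transfer (7 + m) 1 H G (+-comm 1 (11 + m)) (large₁ m)
                               (↭.↭-sym G≈H) (S , dom , ∣S∣≡1)
    in subst (2 ≤_) ∣S′∣≡1 (minimal S′ dom′)
  lower S dom (suc (suc s)) _ = s≤s (s≤s z≤n)

theorem12 : Recognizable 𝓗
theorem12 (n , G) (n′ , H) (12≤n , γ≡2) H≈G
  -- The deck has one card per vertex, so equal decks force equal orders.
  with ≡.trans (sym (length-deck H)) (≡.trans (↭ₚ.xs↭ys⇒|xs|≡|ys| H≈G) (length-deck G))
... | ≡.refl with m≤n⇒∃[o]m+o≡n 12≤n
...   | m , ≡.refl = 12≤n , γ≡2-transfer m G H (↭.↭-sym H≈G) γ≡2
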